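{- Let $G$ be a finite group of order $n$ with identity $e$, and let $S\subseteq G\setminus\{e\}$ satisfy $S=S^{ -1}$ and $G=\langle S\rangle$. If $|S|=n-2$, then $\gamma_{S}(\mathrm{Cay}(S:G))=2$.
   Context: $\mathrm{Cay}(S:G)$ is the simple graph with vertex set $G$ in which $a$ and $b$ are adjacent if and only if $ab^{ -1}\in S$. For a graph $\Gamma$, $N[v]$ denotes the closed neighborhood of $v$ (the vertex $v$ together with all its neighbors). A signed dominating function of $\Gamma$ is a function $g:V(\Gamma)\to\{ -1,1\}$ with $\sum_{u\in N[v]}g(u)>0$ for every $v\in V(\Gamma)$; its weight is $\sum_{v\in V(\Gamma)}g(v)$. The signed domination number $\gamma_{S}(\Gamma)$ is the minimum weight of a signed dominating function of $\Gamma$ (the subscript $S$ in $\gamma_S$ is part of the notation and unrelated to the set $S$). -}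

module Defs where

open import Algebra.Bundles using (Group)
import Algebra.Properties.Group as GroupProperties
open import Data.Fin.Base using (Fin)
open import Data.Fin.Properties using (inj⇒≟)
open import Data.Integer.Base as ℤ using (ℤ; 0ℤ; 1ℤ; -1ℤ)
open import Data.List.Base using (List; allFin; filter; foldr; length; map)
open import Data.Nat.Base using (ℕ)
open import Data.Product.Base using (∃; _×_; _,_; proj₂)
open import Data.Sum.Base using (_⊎_)
open import Function.Bundles using (Func; Inverse)
open import Function.Properties.Inverse using (Inverse⇒Injection)
open import Level using (Level; _⊔_; suc)
open import Relation.Binary.Bundles using (Setoid)
open import Relation.Binary.Core using (Rel)
import Relation.Binary.Definitions as B
open import Relation.Binary.PropositionalEquality as ≡ using (_≡_)
open import Relation.Nullary.Decidable using (_⊎-dec_)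
open import Relation.Unary using (Pred; Decidable; _∈_; _∉_; _≐_)

private
  variable
    a b c ℓ p v : Level

HasCardinality : Setoid a ℓ → ℕ → Set (a ⊔ ℓ)
HasCardinality A n = Inverse A (≡.setoid (Fin n))

-- The list `elements` contains each ≈-class exactly once, so for a predicate
-- respecting ≈, `card` and `sumOver` do not depend on the chosen enumeration.
module FiniteSetoid (A : Setoid a ℓ) {n : ℕ} (enum : HasCardinality A n) where
  open Setoid A

  elements : List Carrier
  elements = map (Inverse.from enum) (allFin n)

  _≈?_ : B.Decidable _≈_
  _≈?_ = inj⇒≟ (Inverse⇒Injection enum)

  card : {P : Pred Carrier p} → Decidable P → ℕ
  card P? = length (filter P? elements)

  sumOver : {P : Pred Carrier p} → Decidable P → (Carrier → ℤ) → ℤ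
  sumOver P? f = foldr ℤ._+_ 0ℤ (map f (filter P? elements))

  sumAll : (Carrier → ℤ) → ℤ
  sumAll f = foldr ℤ._+_ 0ℤ (map f elements)

record FiniteSimpleGraph v ℓ a : Set (suc (v ⊔ ℓ ⊔ a)) where
  field
    vertices : Setoid v ℓ
    order    : ℕ
    enum     : HasCardinality vertices order

  open Setoid vertices public using (_≈_) renaming (Carrier to Vertex)

  field
    _~_      : Rel Vertex a
    ~-resp   : _~_ B.Respects₂ _≈_
    ~-sym    : B.Symmetric _~_
    ~-irrefl : B.Irreflexive _≈_ _~_
    _~?_     : B.Decidable _~_

module _ (Γ : FiniteSimpleGraph v ℓ a) where
  open FiniteSimpleGraph Γ
  open FiniteSetoid vertices enum

  N[_] : Vertex → Pred Vertex (ℓ ⊔ a)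
  N[ x ] u = u ≈ x ⊎ u ~ x

  N[_]? : (x : Vertex) → Decidable N[ x ]
  N[ x ]? u = (u ≈? x) ⊎-dec (u ~? x)

  VertexFunction : Set (v ⊔ ℓ)
  VertexFunction = Func vertices (≡.setoid ℤ)

  record IsSignedDominating (g : VertexFunction) : Set v where
    open Func g using (to)
    field
      signed     : ∀ x → to x ≡ -1ℤ ⊎ to x ≡ 1ℤ
      dominating : ∀ x → sumOver N[ x ]? to ℤ.> 0ℤ

  weight : VertexFunction → ℤ
  weight g = sumAll (Func.to g)

  -- `IsSignedDominationNumber k` says that γ_S(Γ) = k: the minimum weight is
  -- attained and is a lower bound, which determines k uniquely.
  record IsSignedDominationNumber (k : ℤ) : Set (v ⊔ ℓ) where
    field
      attained   : ∃ λ g → IsSignedDominating g × weight g ≡ k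
      lowerBound : ∀ g → IsSignedDominating g → k ℤ.≤ weight g

module _ (G : Group c ℓ) where
  open Group G

  Inverses : Pred Carrier p → Pred Carrier (c ⊔ ℓ ⊔ p)
  Inverses S x = ∃ λ s → s ∈ S × x ≈ s ⁻¹

  data Generated (S : Pred Carrier p) : Pred Carrier (c ⊔ ℓ ⊔ p) where
    gen  : ∀ {x} → x ∈ S → x ∈ Generated S
    unit : ε ∈ Generated S
    mul  : ∀ {x y} → x ∈ Generated S → y ∈ Generated S → x ∙ y ∈ Generated S
    inv  : ∀ {x} → x ∈ Generated S → x ⁻¹ ∈ Generated S
    resp : ∀ {x y} → x ≈ y → x ∈ Generated S → y ∈ Generated S

  Cay : {n : ℕ} → HasCardinality setoid n →
        (S : Pred Carrier p) → S B.Respects _≈_ → Decidable S →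
        ε ∉ S → S ≐ Inverses S → FiniteSimpleGraph c ℓ p
  Cay {n = n} enum S S-resp S? ε∉S S≐S⁻¹ = record
    { vertices = setoid
    ; order    = n
    ; enum     = enum
    ; _~_      = λ x y → x ∙ y ⁻¹ ∈ S
    ; ~-resp   = (λ y≈z → S-resp (∙-congˡ (⁻¹-cong y≈z)))
               , (λ x≈z → S-resp (∙-congʳ x≈z))
    ; ~-sym    = λ {x} {y} xy⁻¹∈S →
                   proj₂ S≐S⁻¹ (x ∙ y ⁻¹ , xy⁻¹∈S , swap x y)
    ; ~-irrefl = λ {x} {y} x≈y xy⁻¹∈S →
                   ε∉S (S-resp (trans (∙-congʳ x≈y) (inverseʳ y)) xy⁻¹∈S)
    ; _~?_     = λ x y → S? (x ∙ y ⁻¹)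
    }
    where
    open GroupProperties G using (⁻¹-anti-homo-∙; ⁻¹-involutive)

    swap : ∀ x y → y ∙ x ⁻¹ ≈ (x ∙ y ⁻¹) ⁻¹
    swap x y = sym (trans (⁻¹-anti-homo-∙ x (y ⁻¹)) (∙-congʳ (⁻¹-involutive y)))

{-# OPTIONS --safe #-}

-- Besides ε, exactly one element t lies outside S, and t is an involution because
-- S = S⁻¹. So N[v] misses only t v, and the sum of g over N[v] is W − g(t v), where
-- W is the weight of g. As v varies t v takes every value, so a signed dominating
-- g satisfies W > g(u) for every u; since g takes the value 1 somewhere, W ≥ 2.
-- Conversely every ±1 function of weight 2 is dominating, and one exists because
-- left multiplication by t has no fixed point, so n is even.
module Submission where

open import Defs
open import Algebra.Bundles using (Group)
open import Data.Integer.Base using (+_; _-_)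
open import Data.Nat.Base using (ℕ)
open import Relation.Binary.Definitions using (_Respects_)
open import Relation.Binary.PropositionalEquality using (_≡_)
open import Relation.Unary using (Pred; Decidable; _∈_; _∉_; _≐_)

open import Algebra.Bundles using (AbelianGroup)
import Algebra.Properties.CommutativeMonoid.Sum as CommutativeMonoidSum
import Algebra.Properties.Group as GroupProperties
open import Data.Fin.Base as Fin using (Fin; zero; suc)
open import Data.Fin.Permutation using (permutation)
import Data.Fin.Properties as Fin
open import Data.Integer.Base as ℤ using (ℤ; 0ℤ; 1ℤ; -1ℤ)
import Data.Integer.Properties as ℤ
open import Data.List.Base using (List; []; _∷_; allFin; filter; foldr; length; map; tabulate)
import Data.List.Membership.Setoid as Membership
open import Data.List.Membership.Propositional.Properties using (∈-allFin)
open import Data.List.Membership.Setoid.Properties using (∈-filter⁺; ∈-map⁺)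
open import Data.List.Properties using (length-map; length-tabulate; map-∘; map-cong; map-tabulate)
open import Data.List.Relation.Unary.All as All using (All; []; _∷_)
import Data.List.Relation.Unary.All.Properties as All
open import Data.List.Relation.Unary.Any as Any using (any?; here; there)
open import Data.List.Relation.Unary.AllPairs using (_∷_)
open import Data.List.Relation.Unary.Unique.Setoid using (Unique)
import Data.List.Relation.Unary.Unique.Setoid.Properties as Unique
open import Data.List.Relation.Unary.Unique.Propositional.Properties using (allFin⁺)
open import Data.Nat.Base as ℕ using (zero; suc)
import Data.Nat.Properties as ℕ
open import Data.Product.Base using (∃; _×_; _,_; proj₁; proj₂)
open import Data.Sum.Base using (_⊎_; inj₁; inj₂)
open import Function.Base using (_∘_; case_of_; id)
open import Function.Bundles using (Func; Inverse)
open import Level using (Level)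
open import Relation.Binary.Bundles using (Setoid)
open import Relation.Binary.Definitions using (tri<; tri≈; tri>)
open import Relation.Binary.PropositionalEquality
  using (_≢_; refl; sym; trans; cong; cong₂; subst; module ≡-Reasoning)
  renaming (setoid to ≡-setoid)
open import Relation.Nullary.Decidable using (yes; no)
open import Relation.Nullary.Negation using (¬_; contradiction)
open import Relation.Unary using (∁)
open import Relation.Unary.Properties using (∁?)

private
  variable
    a ℓ p : Level
    A : Set a
    n : ℕ

-- Splitting lists and sums along a decidable predicate.

∑ : List ℤ → ℤ
∑ = foldr ℤ._+_ 0ℤ

module _ {P : Pred A p} (P? : Decidable P) where

  length-filter-∁ : ∀ xs → length (filter P? xs) ℕ.+ length (filter (∁? P?) xs) ≡ length xs
  length-filter-∁ []       = refl
  length-filter-∁ (x ∷ xs) with P? x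
  ... | yes _ = cong suc (length-filter-∁ xs)
  ... | no  _ = trans (ℕ.+-suc _ _) (cong suc (length-filter-∁ xs))

  ∑-filter-∁ : ∀ (f : A → ℤ) xs →
               ∑ (map f (filter P? xs)) ℤ.+ ∑ (map f (filter (∁? P?) xs)) ≡ ∑ (map f xs)
  ∑-filter-∁ f []       = refl
  ∑-filter-∁ f (x ∷ xs) with P? x
  ... | yes _ = trans (ℤ.+-assoc (f x) _ _) (cong (ℤ._+_ (f x)) (∑-filter-∁ f xs))
  ... | no  _ = begin
    Σ₁ ℤ.+ (f x ℤ.+ Σ₂) ≡⟨ ℤ.+-assoc Σ₁ (f x) Σ₂ ⟨
    Σ₁ ℤ.+ f x ℤ.+ Σ₂   ≡⟨ cong (ℤ._+ Σ₂) (ℤ.+-comm Σ₁ (f x)) ⟩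
    f x ℤ.+ Σ₁ ℤ.+ Σ₂   ≡⟨ ℤ.+-assoc (f x) Σ₁ Σ₂ ⟩
    f x ℤ.+ (Σ₁ ℤ.+ Σ₂) ≡⟨ cong (ℤ._+_ (f x)) (∑-filter-∁ f xs) ⟩
    f x ℤ.+ ∑ (map f xs) ∎
    where
    open ≡-Reasoning
    Σ₁ = ∑ (map f (filter P? xs))
    Σ₂ = ∑ (map f (filter (∁? P?) xs))

∑-nonPositive : ∀ (f : A → ℤ) {xs} → All (λ x → f x ℤ.≤ 0ℤ) xs → ∑ (map f xs) ℤ.≤ 0ℤ
∑-nonPositive f []       = ℤ.≤-refl
∑-nonPositive f (p ∷ ps) = ℤ.+-mono-≤ p (∑-nonPositive f ps)

-- Counting and summing over an enumerated setoid.

module FiniteSetoidProperties (A : Setoid a ℓ) (enum : HasCardinality A n) where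
  open Setoid A renaming (refl to ≈-refl; sym to ≈-sym; trans to ≈-trans)
  open Inverse enum
  open FiniteSetoid A enum
  open Membership A using () renaming (_∈_ to _∈ₗ_)

  elements-unique : Unique A elements
  elements-unique = Unique.map⁺ (≡-setoid (Fin n)) A from-injective (allFin⁺ n)
    where
    from-injective : ∀ {i j} → from i ≈ from j → i ≡ j
    from-injective {i} {j} eq =
      trans (sym (strictlyInverseˡ i)) (trans (to-cong eq) (strictlyInverseˡ j))

  ∈-elements : ∀ x → x ∈ₗ elements
  ∈-elements x =
    Any.map (≈-trans (≈-sym (strictlyInverseʳ x)))
            (∈-map⁺ (≡-setoid (Fin n)) A from-cong (∈-allFin (to x)))

  length-elements : length elements ≡ n
  length-elements = trans (length-map from (allFin n)) (length-tabulate id)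

  module _ {P : Pred Carrier p} (P? : Decidable P) where

    card-∁ : card P? ℕ.+ card (∁? P?) ≡ n
    card-∁ = trans (length-filter-∁ P? elements) length-elements

    sumOver-∁ : ∀ f → sumOver P? f ℤ.+ sumOver (∁? P?) f ≡ sumAll f
    sumOver-∁ f = ∑-filter-∁ P? f elements

    module _ (P-resp : P Respects _≈_) {x : Carrier} (Px : P x) where

      -- The enumeration is complete, so the filtered list is not empty. Two entries would both be ≈
      -- `x`, while entries of the enumeration are pairwise inequivalent. Hence the sum has a single
      -- term.
      sumOver-singleton : (∀ {y} → P y → y ≈ x) →
                          ∀ {f} → (∀ {y z} → y ≈ z → f y ≡ f z) → sumOver P? f ≡ f x
      sumOver-singleton unique {f} f-cong
        with filter P? elements
           | ∈-filter⁺ A P? P-resp (∈-elements x) Px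
           | Unique.filter⁺ A P? elements-unique
           | All.all-filter P? elements
      ... | y ∷ []    | _ | _               | Py ∷ _      =
        trans (ℤ.+-identityʳ (f y)) (f-cong (unique Py))
      ... | y ∷ z ∷ _ | _ | (y≉z ∷ _) ∷ _   | Py ∷ Pz ∷ _ =
        contradiction (≈-trans (unique Py) (≈-sym (unique Pz))) y≉z

      -- The filtered list has two inequivalent entries, and completeness places `x` at one of them;
      -- the entry at the other position is the witness. Completeness is abstracted together with
      -- the list, so that it applies to every further element of `P` as well.
      card≡2⇒other : card P? ≡ 2 → ∃ λ y → P y × ¬ y ≈ x × (∀ {z} → P z → z ≈ x ⊎ z ≈ y)
      card≡2⇒other card≡2
        with filter P? elements
           | (λ {y} → ∈-filter⁺ A P? P-resp (∈-elements y))
           | Unique.filter⁺ A P? elements-unique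
           | All.all-filter P? elements
      ... | y ∷ z ∷ [] | complete | (y≉z ∷ _) ∷ _ | Py ∷ Pz ∷ _ with complete Px
      ...   | here x≈y         = z , Pz , (λ z≈x → y≉z (≈-sym (≈-trans z≈x x≈y))) , λ Pw →
        case complete Pw of λ where
          (here w≈y)         → inj₁ (≈-trans w≈y (≈-sym x≈y))
          (there (here w≈z)) → inj₂ w≈z
      ...   | there (here x≈z) = y , Py , (λ y≈x → y≉z (≈-trans y≈x x≈z)) , λ Pw →
        case complete Pw of λ where
          (here w≈y)         → inj₂ w≈y
          (there (here w≈z)) → inj₁ (≈-trans w≈z (≈-sym x≈z))

  -- This carries a function built on `Fin n` over to the setoid without changing its total.
  sumAll-to : ∀ (h : Fin n → ℤ) → sumAll (h ∘ to) ≡ ∑ (tabulate h)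
  sumAll-to h = cong ∑ (begin
    map (h ∘ to) (map from (allFin n)) ≡⟨ map-∘ (allFin n) ⟨
    map (h ∘ to ∘ from) (allFin n)     ≡⟨ map-cong (cong h ∘ strictlyInverseˡ) (allFin n) ⟩
    map h (allFin n)                   ≡⟨ map-tabulate id h ⟩
    tabulate h                         ∎)
    where open ≡-Reasoning

-- Parity from a fixed-point-free involution.

module _ where
  open CommutativeMonoidSum ℕ.+-0-commutativeMonoid

  sum-1 : ∀ {n} {f : Fin n → ℕ} → (∀ i → f i ≡ 1) → sum f ≡ n
  sum-1 {zero}  f≡1 = refl
  sum-1 {suc n} f≡1 = cong₂ ℕ._+_ (f≡1 zero) (sum-1 (f≡1 ∘ suc))

  -- Each 2-cycle of π has exactly one element that is smaller than its image.
  fixedPointFree-involution⇒even : (π : Fin n → Fin n) → (∀ i → π (π i) ≡ i) →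
                                   (∀ i → π i ≢ i) → ∃ λ k → n ≡ k ℕ.* 2
  fixedPointFree-involution⇒even {n} π π-invol π-free = sum ascent , (begin
    n                                     ≡⟨ sum-1 ascent-once ⟨
    sum (λ i → ascent i ℕ.+ ascent (π i)) ≡⟨ ∑-distrib-+ ascent (ascent ∘ π) ⟩
    -- Reindexing by the permutation π shows that the smaller and the larger elements of the
    -- 2-cycles are equally many.
    sum ascent ℕ.+ sum (ascent ∘ π)       ≡⟨ cong (sum ascent ℕ.+_) (sum-permute ascent π-perm) ⟨
    sum ascent ℕ.+ sum ascent             ≡⟨ cong (sum ascent ℕ.+_) (ℕ.+-identityʳ _) ⟨
    2 ℕ.* sum ascent                      ≡⟨ ℕ.*-comm 2 (sum ascent) ⟩
    sum ascent ℕ.* 2                      ∎)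
    where
    open ≡-Reasoning

    π-perm = permutation π π π-invol π-invol

    ascent : Fin n → ℕ
    ascent i with i Fin.<? π i
    ... | yes _ = 1
    ... | no  _ = 0

    ascent-once : ∀ i → ascent i ℕ.+ ascent (π i) ≡ 1
    ascent-once i with i Fin.<? π i | π i Fin.<? π (π i)
    ... | yes i<πi | yes πi<ππi =
      contradiction (subst (π i Fin.<_) (π-invol i) πi<ππi) (Fin.<-asym i<πi)
    ... | yes _    | no _       = refl
    ... | no _     | yes _      = refl
    -- Since `π (π i)` is `i`, both orders between `i` and `π i` fail, which leaves only a fixed
    -- point.
    ... | no i≮πi  | no πi≮ππi  with Fin.<-cmp i (π i)
    ...   | tri< i<πi _ _ = contradiction i<πi i≮πi
    ...   | tri≈ _ i≡πi _ = contradiction (sym i≡πi) (π-free i)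
    ...   | tri> _ _ πi<i = contradiction (subst (π i Fin.<_) (sym (π-invol i)) πi<i) πi≮ππi

-- Signed functions of weight 2.

Signed : {A : Set a} → (A → ℤ) → Set a
Signed f = ∀ x → f x ≡ -1ℤ ⊎ f x ≡ 1ℤ

-- Start from two values 1 and prepend cancelling pairs 1, -1. The length is written with `suc k`
-- because the empty domain only has weight 0.
signed-weight-2 : ∀ k → ∃ λ (h : Fin (suc k ℕ.* 2) → ℤ) → Signed h × ∑ (tabulate h) ≡ + 2
signed-weight-2 zero    = (λ _ → 1ℤ) , (λ _ → inj₂ refl) , refl
signed-weight-2 (suc k) with signed-weight-2 k
... | h , h-signed , weight≡2 = h′ , h′-signed , cong (λ w → 1ℤ ℤ.+ (-1ℤ ℤ.+ w)) weight≡2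
  where
  h′ : Fin (suc (suc k) ℕ.* 2) → ℤ
  h′ zero          = 1ℤ
  h′ (suc zero)    = -1ℤ
  h′ (suc (suc i)) = h i

  h′-signed : Signed h′
  h′-signed zero          = inj₂ refl
  h′-signed (suc zero)    = inj₁ refl
  h′-signed (suc (suc i)) = h-signed i

theorem2p4 : ∀ {c ℓ p} (G : Group c ℓ)
    (n : ℕ) (enum : HasCardinality (Group.setoid G) n)
    (S : Pred (Group.Carrier G) p)
    (S-resp : S Respects (Group._≈_ G)) (S? : Decidable S)
    (ε∉S : Group.ε G ∉ S) (S≐S⁻¹ : S ≐ Inverses G S) →
    (∀ x → x ∈ Generated G S) →
    + FiniteSetoid.card (Group.setoid G) enum S? ≡ + n - + 2 →
    IsSignedDominationNumber (Cay G enum S S-resp S? ε∉S S≐S⁻¹) (+ 2)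
theorem2p4 G n enum S S-resp S? ε∉S S≐S⁻¹ _ card≡n-2 = record
  { attained   = attained
  ; lowerBound = lowerBound
  }
  where
  open Group G hiding (_-_) renaming (refl to ≈-refl; sym to ≈-sym; trans to ≈-trans)
  open GroupProperties G
  open Inverse enum
  open FiniteSetoid setoid enum
  open FiniteSetoidProperties setoid enum

  Γ = Cay G enum S S-resp S? ε∉S S≐S⁻¹

  -- The involution outside `S`.

  ∁S-resp : ∁ S Respects _≈_
  ∁S-resp x≈y x∉S y∈S = x∉S (S-resp (≈-sym x≈y) y∈S)

  -- The hypothesis is an equation of integers, so 2 can be added back without truncation before
  -- returning to ℕ.
  card-∁S≡2 : card (∁? S?) ≡ 2
  card-∁S≡2 = ℕ.+-cancelˡ-≡ (card S?) _ _ (trans (card-∁ S?) (sym (ℤ.+-injective (begin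
    + card S? ℤ.+ + 2            ≡⟨ cong (ℤ._+ + 2) card≡n-2 ⟩
    + n - + 2 ℤ.+ + 2            ≡⟨ ℤ.+-assoc (+ n) (ℤ.- + 2) (+ 2) ⟩
    + n ℤ.+ 0ℤ                   ≡⟨ ℤ.+-identityʳ (+ n) ⟩
    + n                          ∎))))
    where open ≡-Reasoning

  nonIdentity : ∃ λ t → t ∉ S × ¬ t ≈ ε × (∀ {x} → x ∉ S → x ≈ ε ⊎ x ≈ t)
  nonIdentity = card≡2⇒other (∁? S?) ∁S-resp ε∉S card-∁S≡2

  t : Carrier
  t = proj₁ nonIdentity

  t∉S : t ∉ S
  t∉S = proj₁ (proj₂ nonIdentity)

  t≉ε : ¬ t ≈ ε
  t≉ε = proj₁ (proj₂ (proj₂ nonIdentity))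

  ∉S⇒ε⊎t : ∀ {x} → x ∉ S → x ≈ ε ⊎ x ≈ t
  ∉S⇒ε⊎t = proj₂ (proj₂ (proj₂ nonIdentity))

  -- If `t ⁻¹` were in `S`, so would be its inverse `t`. Thus `t ⁻¹` is `ε` or `t`, and the first
  -- would force `t ≈ ε`.
  t⁻¹≈t : t ⁻¹ ≈ t
  t⁻¹≈t with ∉S⇒ε⊎t (λ t⁻¹∈S → t∉S (proj₂ S≐S⁻¹ (t ⁻¹ , t⁻¹∈S , ≈-sym (⁻¹-involutive t))))
  ... | inj₁ t⁻¹≈ε = contradiction (⁻¹-injective (≈-trans t⁻¹≈ε (≈-sym ε⁻¹≈ε))) t≉ε
  ... | inj₂ t⁻¹≈t = t⁻¹≈t

  tx≉x : ∀ x → ¬ t ∙ x ≈ x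
  tx≉x x tx≈x = t≉ε (identityˡ-unique t x tx≈x)

  ttx≈x : ∀ x → t ∙ (t ∙ x) ≈ x
  ttx≈x x = ≈-trans (∙-congʳ (≈-sym t⁻¹≈t)) (\\-leftDividesʳ t x)

  -- Closed neighborhoods and their complements.

  tv∉N[v] : ∀ v → t ∙ v ∉ N[ Γ ] v
  tv∉N[v] v (inj₁ tv≈v)   = tx≉x v tv≈v
  tv∉N[v] v (inj₂ tvv⁻¹∈S) = t∉S (S-resp (//-rightDividesʳ v t) tvv⁻¹∈S)

  -- A vertex `u` that is not adjacent to `v` has `u ∙ v ⁻¹` equal to `ε` or `t`; the value `ε`
  -- means `u ≈ v`, which `N[v]` contains.
  ∉N[v]⇒≈tv : ∀ v {u} → u ∉ N[ Γ ] v → u ≈ t ∙ v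
  ∉N[v]⇒≈tv v {u} u∉N with ∉S⇒ε⊎t (u∉N ∘ inj₂)
  ... | inj₁ uv⁻¹≈ε = contradiction (inj₁ (x∙y⁻¹≈ε⇒x≈y u v uv⁻¹≈ε)) u∉N
  ... | inj₂ uv⁻¹≈t = ≈-trans (≈-sym (//-rightDividesˡ v u)) (∙-congʳ uv⁻¹≈t)

  ∁N[v]-resp : ∀ v → ∁ (N[ Γ ] v) Respects _≈_
  ∁N[v]-resp v x≈y x∉N (inj₁ y≈v)   = x∉N (inj₁ (≈-trans x≈y y≈v))
  ∁N[v]-resp v x≈y x∉N (inj₂ yv⁻¹∈S) = x∉N (inj₂ (S-resp (∙-congʳ (≈-sym x≈y)) yv⁻¹∈S))

  -- Split the total along `N[v]`: the complement is the single class of `t ∙ v`.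
  sumOver-N[_] : ∀ v (g : VertexFunction Γ) →
                 sumOver (N[ Γ ]? v) (Func.to g) ℤ.+ Func.to g (t ∙ v) ≡ weight Γ g
  sumOver-N[ v ] g = trans
    (cong (ℤ._+_ (sumOver (N[ Γ ]? v) (Func.to g)))
      (sym (sumOver-singleton (∁? (N[ Γ ]? v)) (∁N[v]-resp v) (tv∉N[v] v) (∉N[v]⇒≈tv v) (Func.cong g))))
    (sumOver-∁ (N[ Γ ]? v) (Func.to g))

  -- The lower bound.

  lowerBound : ∀ g → IsSignedDominating Γ g → + 2 ℤ.≤ weight Γ g
  lowerBound g dom with any? (λ x → Func.to g x ℤ.≟ 1ℤ) elements
  -- Integrality turns a weight above 1 into a weight of at least 2.
  ... | yes some≡1 = ℤ.i<j⇒suc[i]≤j (begin-strict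
    1ℤ                   ≡⟨ ℤ.+-identityˡ 1ℤ ⟨
    0ℤ ℤ.+ 1ℤ            <⟨ ℤ.+-monoˡ-< 1ℤ (dominating v) ⟩
    Σ ℤ.+ 1ℤ             ≡⟨ cong (ℤ._+_ Σ) (trans (g.cong (\\-leftDividesˡ t u)) gu≡1) ⟨
    Σ ℤ.+ g.to (t ∙ v)   ≡⟨ sumOver-N[ v ] g ⟩
    weight Γ g           ∎)
    where
    open ℤ.≤-Reasoning
    open IsSignedDominating dom
    module g = Func g
    u = proj₁ (Any.satisfied some≡1)
    gu≡1 = proj₂ (Any.satisfied some≡1)
    -- This choice makes `t ∙ v ≈ u`, so the one vertex missed by `N[v]` is one where `g` is 1.
    v = t \\ u
    Σ = sumOver (N[ Γ ]? v) g.to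
  -- If the value 1 never occurs, every value is -1, and the sum over `N[ε]` cannot be positive.
  ... | no none≡1 = contradiction (dominating ε) (ℤ.≤⇒≯ (∑-nonPositive (Func.to g)
      (All.filter⁺ (N[ Γ ]? ε) (All.map nonPositive (All.¬Any⇒All¬ elements none≡1)))))
    where
    open IsSignedDominating dom
    nonPositive : ∀ {x} → Func.to g x ≢ 1ℤ → Func.to g x ℤ.≤ 0ℤ
    nonPositive {x} gx≢1 with signed x
    ... | inj₁ gx≡-1 = ℤ.≤-trans (ℤ.≤-reflexive gx≡-1) ℤ.-≤+
    ... | inj₂ gx≡1  = contradiction gx≡1 gx≢1

  -- Attaining weight 2.

  weight≡2⇒dominating : ∀ g → Signed (Func.to g) → weight Γ g ≡ + 2 → IsSignedDominating Γ g
  weight≡2⇒dominating g g-signed weight≡2 = record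
    { signed     = g-signed
    ; dominating = λ v → positive (g-signed (t ∙ v)) (trans (sumOver-N[ v ] g) weight≡2)
    }
    where
    open GroupProperties (AbelianGroup.group ℤ.+-0-abelianGroup)
      using () renaming (∙-cancelʳ to +-cancelʳ)

    -- Here `i` is a neighborhood sum and `j` the missed value, so `i` is 2 - `j`, that is 3 or 1.
    positive : ∀ {i j} → j ≡ -1ℤ ⊎ j ≡ 1ℤ → i ℤ.+ j ≡ + 2 → i ℤ.> 0ℤ
    positive {i} (inj₁ refl) eq = subst (ℤ._> 0ℤ) (sym (+-cancelʳ -1ℤ i (+ 3) eq)) (ℤ.+<+ ℕ.z<s)
    positive {i} (inj₂ refl) eq = subst (ℤ._> 0ℤ) (sym (+-cancelʳ 1ℤ i 1ℤ eq)) (ℤ.+<+ ℕ.z<s)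

  -- Left multiplication by `t`, transported to `Fin n` along the enumeration, is an involution
  -- without fixed points.
  n-even : ∃ λ k → n ≡ k ℕ.* 2
  n-even = fixedPointFree-involution⇒even π π-invol π-free
    where
    π : Fin n → Fin n
    π i = to (t ∙ from i)

    π-invol : ∀ i → π (π i) ≡ i
    π-invol i = trans (to-cong (≈-trans (∙-congˡ (strictlyInverseʳ _)) (ttx≈x (from i))))
                      (strictlyInverseˡ i)

    π-free : ∀ i → π i ≢ i
    π-free i πi≡i = tx≉x (from i) (≈-trans (≈-sym (strictlyInverseʳ _)) (from-cong πi≡i))

  attained : ∃ λ g → IsSignedDominating Γ g × weight Γ g ≡ + 2
  attained = construct n-even
    where
    construct : (∃ λ k → n ≡ k ℕ.* 2) → ∃ λ g → IsSignedDominating Γ g × weight Γ g ≡ + 2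
    -- Order 0 is impossible, since the group contains `ε`.
    construct (zero  , n≡0)    = contradiction (subst Fin n≡0 (to ε)) Fin.¬Fin0
    construct (suc k , n≡2+2k) = g , weight≡2⇒dominating g (h-signed ∘ to) weight≡2 , weight≡2
      where
      -- The enumeration is indexed by `n` itself, so the function is moved along the equation for
      -- `n`.
      signed-function : ∃ λ (h : Fin n → ℤ) → Signed h × ∑ (tabulate h) ≡ + 2
      signed-function = subst (λ m → ∃ λ (h : Fin m → ℤ) → Signed h × ∑ (tabulate h) ≡ + 2)
                              (sym n≡2+2k) (signed-weight-2 k)

      h = proj₁ signed-function
      h-signed = proj₁ (proj₂ signed-function)

      g : VertexFunction Γ
      g = record { to = h ∘ to ; cong = cong h ∘ to-cong }

      weight≡2 : weight Γ g ≡ + 2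
      weight≡2 = trans (sumAll-to h) (proj₂ (proj₂ signed-function))
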